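{- Let $S,T$ be as in the context and let $\mathrm{Pr}_T(x)$ be any $\Sigma_1$ provability predicate of $T$. Then: 1. If $\mathrm{Pr}_T(x)$ satisfies $\mathbf{E}$ and $\mathbf{D3}$, then $T\nvdash\mathrm{Con}^{\mathrm{S}}_T$. 2. If $\mathrm{Pr}_T(x)$ satisfies $\mathbf{\Sigma_1C}^-$, then $T\nvdash\mathrm{Con}^{\mathrm{S}}_T$.
   Context: $\mathcal{L}_A=\{0,\mathsf{s},+,\times,\leq\}$ is the language of first-order arithmetic, and "formula" means $\mathcal{L}_A$-formula; $\ulcorner\varphi\urcorner$ is the numeral of the Gödel number of $\varphi$. $\Sigma_1$ formulas are those of the form $\exists\vec{x}\,\delta$ with $\delta$ a $\Delta_0$ formula. $S$ and $T$ are consistent c.e. extensions of Peano Arithmetic $\mathsf{PA}$ in the language $\mathcal{L}_A$ such that $T$ is stronger than $S$ (every theorem of $S$ is a theorem of $T$; $S=T$ is allowed). A formula $\mathrm{Pr}_T(x)$ is a provability predicate of $T$ if for every formula $\varphi$: $T\vdash\varphi$ if and only if $S\vdash\mathrm{Pr}_T(\ulcorner\varphi\urcorner)$. A $\Sigma_1$ provability predicate is one that is a $\Sigma_1$ formula. $\mathrm{Con}^{\mathrm{S}}_T := \{\mathrm{Pr}_T(\ulcorner\varphi\urcorner)\to\neg\,\mathrm{Pr}_T(\ulcorner\neg\varphi\urcorner)\mid \varphi \text{ a formula}\}$; $T\nvdash\mathrm{Con}^{\mathrm{S}}_T$ means that $T$ fails to prove at least one member of this set. Conditions on $\mathrm{Pr}_T(x)$: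 - $\mathbf{E}$: for all formulas $\varphi,\psi$, if $T\vdash\varphi\leftrightarrow\psi$, then $S\vdash\mathrm{Pr}_T(\ulcorner\varphi\urcorner)\leftrightarrow\mathrm{Pr}_T(\ulcorner\psi\urcorner)$. - $\mathbf{D3}$: $S\vdash\mathrm{Pr}_T(\ulcorner\varphi\urcorner)\to\mathrm{Pr}_T(\ulcorner\mathrm{Pr}_T(\ulcorner\varphi\urcorner)\urcorner)$ for every formula $\varphi$. - $\mathbf{\Sigma_1C}^-$: there is a finite subtheory $T_0$ of $T$ (a finite set of sentences that are theorems of $T$) such that for every $\Sigma_1$ sentence $\varphi$, $S\vdash\varphi\to\mathrm{Pr}_T(\ulcorner\bigwedge T_0\to\varphi\urcorner)$; by convention $\bigwedge\emptyset$ is $0=0$. -}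

module Defs where

open import Data.Nat.Base using (ℕ; zero; suc; _+_; _*_; _≤_; _<_)
open import Data.Nat.Properties
open import Data.Fin.Base using (Fin; zero; suc; toℕ)
open import Data.Fin.Properties using (toℕ-injective)
open import Data.List.Base using (List; []; _∷_; map)
open import Data.List.Membership.Propositional using (_∈_)
open import Data.List.Relation.Unary.All using (All)
open import Data.Vec.Base using (Vec; []; _∷_; lookup)
open import Data.Vec.Relation.Binary.Pointwise.Inductive using (Pointwise)
open import Data.Product.Base using (Σ; ∃-syntax; _×_; _,_)
open import Data.Empty using (⊥-elim)
open import Function.Base using (_∘_)
open import Function.Bundles using (_⇔_)
open import Relation.Binary.Definitions using (tri<; tri≈; tri>)
open import Relation.Binary.PropositionalEquality using (_≡_; refl; sym; trans; cong; cong₂)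
open import Relation.Nullary using (¬_)

-- Well-scoped de Bruijn syntax: `Formula n` consists of the formulas (up to
-- renaming of bound variables) whose free variables are among v₀ , … , vₙ₋₁.
-- "A formula" is thus an element of `Formula n` for an arbitrary n, and a
-- sentence is an element of `Formula 0`.

infixl 8 _×̇_
infixl 7 _+̇_
infix  6 _≐_ _≤̇_
infixr 5 _∧̇_
infixr 4 _∨̇_
infixr 3 _⇒_
infix  2 _⇔̇_

data Term (n : ℕ) : Set where
  var  : Fin n → Term n
  0̇    : Term n
  ṡ    : Term n → Term n
  _+̇_  : Term n → Term n → Term n
  _×̇_  : Term n → Term n → Term n

data Formula (n : ℕ) : Set where
  ⊥̇    : Formula n
  _≐_  : Term n → Term n → Formula n
  _≤̇_  : Term n → Term n → Formula n
  _⇒_  : Formula n → Formula n → Formula n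
  _∧̇_  : Formula n → Formula n → Formula n
  _∨̇_  : Formula n → Formula n → Formula n
  ∀̇_   : Formula (suc n) → Formula n
  ∃̇_   : Formula (suc n) → Formula n

Sentence : Set
Sentence = Formula 0

¬̇_ : ∀ {n} → Formula n → Formula n
¬̇ φ = φ ⇒ ⊥̇

_⇔̇_ : ∀ {n} → Formula n → Formula n → Formula n
φ ⇔̇ ψ = (φ ⇒ ψ) ∧̇ (ψ ⇒ φ)

⋀ : ∀ {n} → List (Formula n) → Formula n
⋀ []            = 0̇ ≐ 0̇
⋀ (φ ∷ [])      = φ
⋀ (φ ∷ ψ ∷ φs)  = φ ∧̇ ⋀ (ψ ∷ φs)

closure : ∀ {n} → Formula n → Sentence
closure {zero}  φ = φ
closure {suc n} φ = closure (∀̇ φ)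

numeral : ∀ {n} → ℕ → Term n
numeral zero    = 0̇
numeral (suc k) = ṡ (numeral k)

Subst : ℕ → ℕ → Set
Subst m n = Fin m → Term n

subT : ∀ {m n} → Subst m n → Term m → Term n
subT σ (var i)  = σ i
subT σ 0̇        = 0̇
subT σ (ṡ t)    = ṡ (subT σ t)
subT σ (t +̇ u)  = subT σ t +̇ subT σ u
subT σ (t ×̇ u)  = subT σ t ×̇ subT σ u

wkT : ∀ {n} → Term n → Term (suc n)
wkT = subT (var ∘ suc)

lift : ∀ {m n} → Subst m n → Subst (suc m) (suc n)
lift σ zero    = var zero
lift σ (suc i) = wkT (σ i)

sub : ∀ {m n} → Subst m n → Formula m → Formula n
sub σ ⊥̇        = ⊥̇
sub σ (t ≐ u)  = subT σ t ≐ subT σ u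
sub σ (t ≤̇ u)  = subT σ t ≤̇ subT σ u
sub σ (φ ⇒ ψ)  = sub σ φ ⇒ sub σ ψ
sub σ (φ ∧̇ ψ)  = sub σ φ ∧̇ sub σ ψ
sub σ (φ ∨̇ ψ)  = sub σ φ ∨̇ sub σ ψ
sub σ (∀̇ φ)    = ∀̇ sub (lift σ) φ
sub σ (∃̇ φ)    = ∃̇ sub (lift σ) φ

wk : ∀ {n} → Formula n → Formula (suc n)
wk = sub (var ∘ suc)

fromSentence : ∀ {n} → Sentence → Formula n
fromSentence = sub (λ ())

inst : ∀ {n} → Term n → Subst (suc n) n
inst t zero    = t
inst t (suc i) = var i

infix 9 _[_]

_[_] : ∀ {n} → Formula (suc n) → Term n → Formula n
φ [ t ] = sub (inst t) φ

data Δ₀ {n : ℕ} : Formula n → Set where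
  ⊥̇    : Δ₀ ⊥̇
  _≐_  : ∀ t u → Δ₀ (t ≐ u)
  _≤̇_  : ∀ t u → Δ₀ (t ≤̇ u)
  _⇒_  : ∀ {φ ψ} → Δ₀ φ → Δ₀ ψ → Δ₀ (φ ⇒ ψ)
  _∧̇_  : ∀ {φ ψ} → Δ₀ φ → Δ₀ ψ → Δ₀ (φ ∧̇ ψ)
  _∨̇_  : ∀ {φ ψ} → Δ₀ φ → Δ₀ ψ → Δ₀ (φ ∨̇ ψ)
  ∀≤   : ∀ {φ} (t : Term n) → Δ₀ φ → Δ₀ (∀̇ (var zero ≤̇ wkT t ⇒ φ))
  ∃≤   : ∀ {φ} (t : Term n) → Δ₀ φ → Δ₀ (∃̇ (var zero ≤̇ wkT t ∧̇ φ))

data Σ₁ {n : ℕ} : Formula n → Set where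
  matrix : ∀ {φ} → Δ₀ φ → Σ₁ φ
  ∃̇_     : ∀ {φ} → Σ₁ φ → Σ₁ (∃̇ φ)

Theory : Set₁
Theory = Sentence → Set

infix 1 _∣_⊢_ _⊢_ _⊑_ _⊬_

data _∣_⊢_ (T : Theory) : ∀ {n} → List (Formula n) → Formula n → Set where
  axiom : ∀ {n} {Γ : List (Formula n)} {φ} → T φ → T ∣ Γ ⊢ fromSentence φ
  hyp   : ∀ {n} {Γ : List (Formula n)} {φ} → φ ∈ Γ → T ∣ Γ ⊢ φ
  ⇒I    : ∀ {n} {Γ : List (Formula n)} {φ ψ} → T ∣ φ ∷ Γ ⊢ ψ → T ∣ Γ ⊢ φ ⇒ ψ
  ⇒E    : ∀ {n} {Γ : List (Formula n)} {φ ψ} → T ∣ Γ ⊢ φ ⇒ ψ → T ∣ Γ ⊢ φ → T ∣ Γ ⊢ ψ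
  ∧I    : ∀ {n} {Γ : List (Formula n)} {φ ψ} → T ∣ Γ ⊢ φ → T ∣ Γ ⊢ ψ → T ∣ Γ ⊢ φ ∧̇ ψ
  ∧E₁   : ∀ {n} {Γ : List (Formula n)} {φ ψ} → T ∣ Γ ⊢ φ ∧̇ ψ → T ∣ Γ ⊢ φ
  ∧E₂   : ∀ {n} {Γ : List (Formula n)} {φ ψ} → T ∣ Γ ⊢ φ ∧̇ ψ → T ∣ Γ ⊢ ψ
  ∨I₁   : ∀ {n} {Γ : List (Formula n)} {φ ψ} → T ∣ Γ ⊢ φ → T ∣ Γ ⊢ φ ∨̇ ψ
  ∨I₂   : ∀ {n} {Γ : List (Formula n)} {φ ψ} → T ∣ Γ ⊢ ψ → T ∣ Γ ⊢ φ ∨̇ ψ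
  ∨E    : ∀ {n} {Γ : List (Formula n)} {φ ψ χ} →
          T ∣ Γ ⊢ φ ∨̇ ψ → T ∣ φ ∷ Γ ⊢ χ → T ∣ ψ ∷ Γ ⊢ χ → T ∣ Γ ⊢ χ
  raa   : ∀ {n} {Γ : List (Formula n)} {φ} → T ∣ ¬̇ φ ∷ Γ ⊢ ⊥̇ → T ∣ Γ ⊢ φ
  ∀I    : ∀ {n} {Γ : List (Formula n)} {φ} → T ∣ map wk Γ ⊢ φ → T ∣ Γ ⊢ ∀̇ φ
  ∀E    : ∀ {n} {Γ : List (Formula n)} {φ} → T ∣ Γ ⊢ ∀̇ φ → ∀ t → T ∣ Γ ⊢ φ [ t ]
  ∃I    : ∀ {n} {Γ : List (Formula n)} {φ} t → T ∣ Γ ⊢ φ [ t ] → T ∣ Γ ⊢ ∃̇ φ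
  ∃E    : ∀ {n} {Γ : List (Formula n)} {φ χ} →
          T ∣ Γ ⊢ ∃̇ φ → T ∣ φ ∷ map wk Γ ⊢ wk χ → T ∣ Γ ⊢ χ
  ≐I    : ∀ {n} {Γ : List (Formula n)} t → T ∣ Γ ⊢ t ≐ t
  ≐E    : ∀ {n} {Γ : List (Formula n)} (φ : Formula (suc n)) {t u} →
          T ∣ Γ ⊢ t ≐ u → T ∣ Γ ⊢ φ [ t ] → T ∣ Γ ⊢ φ [ u ]

_⊢_ : ∀ {n} → Theory → Formula n → Set
T ⊢ φ = T ∣ [] ⊢ φ

Consistent : Theory → Set
Consistent T = ¬ (T ⊢ ⊥̇ {0})

_⊑_ : Theory → Theory → Set
S ⊑ T = ∀ {n} (φ : Formula n) → S ⊢ φ → T ⊢ φ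

_⊬_ : Theory → (Sentence → Set) → Set
T ⊬ Φ = ∃[ φ ] Φ φ × ¬ (T ⊢ φ)

private
  x₀ : ∀ {n} → Term (suc n)
  x₀ = var zero

  x₁ : ∀ {n} → Term (suc (suc n))
  x₁ = var (suc zero)

  x₂ : ∀ {n} → Term (suc (suc (suc n)))
  x₂ = var (suc (suc zero))

shiftSuc : ∀ {n} → Subst (suc n) (suc n)
shiftSuc zero    = ṡ (var zero)
shiftSuc (suc i) = var (suc i)

data PA : Theory where
  suc≠0 : PA (∀̇ ¬̇ (ṡ x₀ ≐ 0̇))
  sucInj : PA (∀̇ ∀̇ (ṡ x₁ ≐ ṡ x₀ ⇒ x₁ ≐ x₀))
  +0    : PA (∀̇ (x₀ +̇ 0̇ ≐ x₀))
  +suc  : PA (∀̇ ∀̇ (x₁ +̇ ṡ x₀ ≐ ṡ (x₁ +̇ x₀)))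
  ×0    : PA (∀̇ (x₀ ×̇ 0̇ ≐ 0̇))
  ×suc  : PA (∀̇ ∀̇ (x₁ ×̇ ṡ x₀ ≐ x₁ ×̇ x₀ +̇ x₁))
  ≤def  : PA (∀̇ ∀̇ (x₁ ≤̇ x₀ ⇔̇ ∃̇ (x₀ +̇ x₂ ≐ x₁)))
  ind   : ∀ {n} (φ : Formula (suc n)) →
          PA (closure (φ [ 0̇ ] ∧̇ (∀̇ (φ ⇒ sub shiftSuc φ)) ⇒ ∀̇ φ))

-- An injective (not surjective) polynomial pairing.
⟨_,_⟩ : ℕ → ℕ → ℕ
⟨ a , b ⟩ = (a + b) * (a + b) + a

-- Every term is uniquely sᵏ(u) with u not of the form s(…); it is coded by k
-- together with the outermost symbol of u and the codes of its arguments.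
lead : ∀ {n} → Term n → ℕ
lead (ṡ t) = suc (lead t)
lead _     = 0

tagT : ∀ {n} → Term n → ℕ
tagT (ṡ t)    = tagT t
tagT 0̇        = 0
tagT (var _)  = 1
tagT (_ +̇ _)  = 2
tagT (_ ×̇ _)  = 3

codeT bodyT : ∀ {n} → Term n → ℕ
codeT t = ⟨ lead t , ⟨ tagT t , bodyT t ⟩ ⟩
bodyT (ṡ t)    = bodyT t
bodyT 0̇        = 0
bodyT (var i)  = toℕ i
bodyT (t +̇ u)  = ⟨ codeT t , codeT u ⟩
bodyT (t ×̇ u)  = ⟨ codeT t , codeT u ⟩

tag : ∀ {n} → Formula n → ℕ
tag ⊥̇        = 0
tag (_ ≐ _)  = 1
tag (_ ≤̇ _)  = 2
tag (_ ⇒ _)  = 3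
tag (_ ∧̇ _)  = 4
tag (_ ∨̇ _)  = 5
tag (∀̇ _)    = 6
tag (∃̇ _)    = 7

code body : ∀ {n} → Formula n → ℕ
code φ = ⟨ tag φ , body φ ⟩
body ⊥̇        = 0
body (t ≐ u)  = ⟨ codeT t , codeT u ⟩
body (t ≤̇ u)  = ⟨ codeT t , codeT u ⟩
body (φ ⇒ ψ)  = ⟨ code φ , code ψ ⟩
body (φ ∧̇ ψ)  = ⟨ code φ , code ψ ⟩
body (φ ∨̇ ψ)  = ⟨ code φ , code ψ ⟩
body (∀̇ φ)    = code φ
body (∃̇ φ)    = code φ

⌜_⌝ : ∀ {m n} → Formula m → Term n
⌜ φ ⌝ = numeral (code φ)

private
  sum-< : ∀ {x y a a′} → a ≤ x → x < y → ¬ (x * x + a ≡ y * y + a′)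
  sum-< {x} {y} {a} {a′} a≤x x<y eq = <-irrefl eq (begin-strict
    x * x + a      ≤⟨ +-monoʳ-≤ (x * x) a≤x ⟩
    x * x + x      ≡⟨ +-comm (x * x) x ⟩
    suc x * x      <⟨ *-monoʳ-< (suc x) (n<1+n x) ⟩
    suc x * suc x  ≤⟨ *-mono-≤ x<y x<y ⟩
    y * y          ≤⟨ m≤m+n (y * y) a′ ⟩
    y * y + a′     ∎)
    where open ≤-Reasoning

⟨⟩-injective : ∀ a b c d → ⟨ a , b ⟩ ≡ ⟨ c , d ⟩ → a ≡ c × b ≡ d
⟨⟩-injective a b c d eq with <-cmp (a + b) (c + d)
... | tri< lt _ _ = ⊥-elim (sum-< (m≤m+n a b) lt eq)
... | tri> _ _ gt = ⊥-elim (sum-< (m≤m+n c d) gt (sym eq))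
... | tri≈ _ e _ = a≡c , +-cancelˡ-≡ a b d (trans e (cong (_+ d) (sym a≡c)))
  where
  a≡c : a ≡ c
  a≡c = +-cancelˡ-≡ ((c + d) * (c + d)) a c
          (trans (cong (λ z → z * z + a) (sym e)) eq)

codeT-injective : ∀ {n} (t u : Term n) → codeT t ≡ codeT u → t ≡ u

private
  bodyT-injective : ∀ {n} (t u : Term n) →
                    lead t ≡ lead u → tagT t ≡ tagT u → bodyT t ≡ bodyT u → t ≡ u
  bodyT-injective (ṡ t) (ṡ u) l e b = cong ṡ (bodyT-injective t u (suc-injective l) e b)
  bodyT-injective 0̇ 0̇ refl refl b = refl
  bodyT-injective (var i) (var j) refl refl b = cong var (toℕ-injective b)
  bodyT-injective (t +̇ t′) (u +̇ u′) refl refl b =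
    let (e , e′) = ⟨⟩-injective (codeT t) (codeT t′) (codeT u) (codeT u′) b
    in cong₂ _+̇_ (codeT-injective t u e) (codeT-injective t′ u′ e′)
  bodyT-injective (t ×̇ t′) (u ×̇ u′) refl refl b =
    let (e , e′) = ⟨⟩-injective (codeT t) (codeT t′) (codeT u) (codeT u′) b
    in cong₂ _×̇_ (codeT-injective t u e) (codeT-injective t′ u′ e′)

codeT-injective t u eq =
  let (l , eq′) = ⟨⟩-injective (lead t) ⟨ tagT t , bodyT t ⟩ (lead u) ⟨ tagT u , bodyT u ⟩ eq
      (e , b)   = ⟨⟩-injective (tagT t) (bodyT t) (tagT u) (bodyT u) eq′
  in bodyT-injective t u l e b

code-injective : ∀ {n} (φ ψ : Formula n) → code φ ≡ code ψ → φ ≡ ψ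

private
  body-injective : ∀ {n} (φ ψ : Formula n) → tag φ ≡ tag ψ → body φ ≡ body ψ → φ ≡ ψ
  body-injective ⊥̇ ⊥̇ refl b = refl
  body-injective (t ≐ t′) (u ≐ u′) refl b =
    let (e , e′) = ⟨⟩-injective (codeT t) (codeT t′) (codeT u) (codeT u′) b
    in cong₂ _≐_ (codeT-injective t u e) (codeT-injective t′ u′ e′)
  body-injective (t ≤̇ t′) (u ≤̇ u′) refl b =
    let (e , e′) = ⟨⟩-injective (codeT t) (codeT t′) (codeT u) (codeT u′) b
    in cong₂ _≤̇_ (codeT-injective t u e) (codeT-injective t′ u′ e′)
  body-injective (φ ⇒ φ′) (ψ ⇒ ψ′) refl b =
    let (e , e′) = ⟨⟩-injective (code φ) (code φ′) (code ψ) (code ψ′) b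
    in cong₂ _⇒_ (code-injective φ ψ e) (code-injective φ′ ψ′ e′)
  body-injective (φ ∧̇ φ′) (ψ ∧̇ ψ′) refl b =
    let (e , e′) = ⟨⟩-injective (code φ) (code φ′) (code ψ) (code ψ′) b
    in cong₂ _∧̇_ (code-injective φ ψ e) (code-injective φ′ ψ′ e′)
  body-injective (φ ∨̇ φ′) (ψ ∨̇ ψ′) refl b =
    let (e , e′) = ⟨⟩-injective (code φ) (code φ′) (code ψ) (code ψ′) b
    in cong₂ _∨̇_ (code-injective φ ψ e) (code-injective φ′ ψ′ e′)
  body-injective (∀̇ φ) (∀̇ ψ) refl b = cong ∀̇_ (code-injective φ ψ b)
  body-injective (∃̇ φ) (∃̇ ψ) refl b = cong ∃̇_ (code-injective φ ψ b)

code-injective φ ψ eq =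
  let (e , b) = ⟨⟩-injective (tag φ) (body φ) (tag ψ) (body ψ) eq in body-injective φ ψ e b

data Rec : ℕ → Set where
  zero  : Rec 0
  suc   : Rec 1
  proj  : ∀ {k} → Fin k → Rec k
  comp  : ∀ {k l} → Rec l → Vec (Rec k) l → Rec k
  prec  : ∀ {k} → Rec k → Rec (suc (suc k)) → Rec (suc k)
  μ     : ∀ {k} → Rec (suc k) → Rec k

infix 1 _·_⇓_

data _·_⇓_ : ∀ {k} → Rec k → Vec ℕ k → ℕ → Set where
  zero  : zero · [] ⇓ 0
  suc   : ∀ {x} → suc · x ∷ [] ⇓ suc x
  proj  : ∀ {k} {xs : Vec ℕ k} i → proj i · xs ⇓ lookup xs i
  comp  : ∀ {k l} {f : Rec l} {gs : Vec (Rec k) l} {xs ys z} →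
          Pointwise (λ g y → g · xs ⇓ y) gs ys → f · ys ⇓ z → comp f gs · xs ⇓ z
  prec₀ : ∀ {k} {f : Rec k} {g xs y} → f · xs ⇓ y → prec f g · 0 ∷ xs ⇓ y
  precₛ : ∀ {k} {f : Rec k} {g xs n y z} →
          prec f g · n ∷ xs ⇓ y → g · n ∷ y ∷ xs ⇓ z → prec f g · suc n ∷ xs ⇓ z
  μ     : ∀ {k} {f : Rec (suc k)} {xs y} →
          f · y ∷ xs ⇓ 0 → (∀ z → z < y → ∃[ v ] (f · z ∷ xs ⇓ suc v)) → μ f · xs ⇓ y

CE : (ℕ → Set) → Set
CE X = Σ (Rec 1) λ f → ∀ n → X n ⇔ (∃[ y ] (f · n ∷ [] ⇓ y))

CETheory : Theory → Set
CETheory T = CE (λ n → ∃[ φ ] (T φ × code φ ≡ n))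

IsProvabilityPredicate : (S T : Theory) → Formula 1 → Set
IsProvabilityPredicate S T Pr = ∀ {n} (φ : Formula n) → (T ⊢ φ) ⇔ (S ⊢ Pr [ ⌜ φ ⌝ ])

ConS : Formula 1 → Sentence → Set
ConS Pr χ = ∃[ n ] Σ (Formula n) λ φ → χ ≡ (Pr [ ⌜ φ ⌝ ] ⇒ ¬̇ (Pr [ ⌜ ¬̇ φ ⌝ ]))

E : (S T : Theory) → Formula 1 → Set
E S T Pr = ∀ {n} (φ ψ : Formula n) → T ⊢ φ ⇔̇ ψ → S ⊢ Pr [ ⌜ φ ⌝ ] ⇔̇ Pr [ ⌜ ψ ⌝ ]

D3 : (S : Theory) → Formula 1 → Set
D3 S Pr = ∀ {n} (φ : Formula n) → S ⊢ Pr [ ⌜ φ ⌝ ] ⇒ Pr [ ⌜ Pr [ ⌜ φ ⌝ ] ⌝ ]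

Σ₁C⁻ : (S T : Theory) → Formula 1 → Set
Σ₁C⁻ S T Pr = Σ (List Sentence) λ T₀ → All (T ⊢_) T₀ ×
  (∀ (φ : Sentence) → Σ₁ φ → S ⊢ φ ⇒ Pr [ ⌜ ⋀ T₀ ⇒ φ ⌝ ])

{-# OPTIONS --safe #-}

-- For a theorem A of T, diagonalisation gives a Σ₁ sentence σ with
-- PA ⊢ σ ⇔ Pr⌜¬(A ⇒ σ)⌝.  If S ⊢ σ ⇒ Pr⌜A ⇒ σ⌝, then T does not prove the
-- instance Pr⌜A ⇒ σ⌝ ⇒ ¬ Pr⌜¬(A ⇒ σ)⌝ of consistency: it would refute σ, hence
-- prove ¬(A ⇒ σ), and then S, and so T, would prove Pr⌜¬(A ⇒ σ)⌝ and σ.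
-- The missing implication is Σ₁C⁻ itself for A = ⋀ T₀, and it follows from D3
-- and E because T ⊢ Pr⌜¬(A ⇒ σ)⌝ ⇔ (A ⇒ σ).
--
-- Diagonalisation needs no representability of substitution.  Instead of
-- substituting a numeral k for x, one adds the conjunct x ≐ k, and the code of
-- the result is then a polynomial in k because numerals have polynomial codes.
module Submission where

open import Defs
open import Data.Fin.Base using (Fin; zero; suc; toℕ)
open import Data.List.Base using (List; []; _∷_; map)
open import Data.List.Relation.Binary.Subset.Propositional using (_⊆_)
open import Data.List.Relation.Binary.Subset.Propositional.Properties using (map⁺; ∷⁺ʳ)
open import Data.List.Relation.Unary.All using (All; []; _∷_)
open import Data.List.Relation.Unary.Any using (here; there)
open import Data.Nat.Base using (ℕ; zero; suc; _+_; _*_)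
open import Data.Nat.Properties using (*-suc; +-comm; +-suc; *-zeroʳ; +-identityʳ)
open import Data.Product.Base using (Σ; ∃-syntax; _×_; _,_)
open import Function.Base using (_∘_)
open import Function.Bundles using (Equivalence)
open import Relation.Binary.PropositionalEquality using (_≡_; refl; sym; trans; cong; cong₂; subst; subst₂)

private
  variable
    l m n : ℕ
    S T : Theory
    Γ Δ : List (Formula n)
    φ ψ χ : Formula n

-- Substitution

subT-cong : {σ τ : Subst m n} → (∀ i → σ i ≡ τ i) → ∀ t → subT σ t ≡ subT τ t
subT-cong e (var i)  = e i
subT-cong e 0̇        = refl
subT-cong e (ṡ t)    = cong ṡ (subT-cong e t)
subT-cong e (t +̇ u)  = cong₂ _+̇_ (subT-cong e t) (subT-cong e u)
subT-cong e (t ×̇ u)  = cong₂ _×̇_ (subT-cong e t) (subT-cong e u)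

subT-id : (t : Term n) → subT var t ≡ t
subT-id (var i)  = refl
subT-id 0̇        = refl
subT-id (ṡ t)    = cong ṡ (subT-id t)
subT-id (t +̇ u)  = cong₂ _+̇_ (subT-id t) (subT-id u)
subT-id (t ×̇ u)  = cong₂ _×̇_ (subT-id t) (subT-id u)

subT-∘ : (τ : Subst m n) (σ : Subst l m) → ∀ t → subT τ (subT σ t) ≡ subT (subT τ ∘ σ) t
subT-∘ τ σ (var i)  = refl
subT-∘ τ σ 0̇        = refl
subT-∘ τ σ (ṡ t)    = cong ṡ (subT-∘ τ σ t)
subT-∘ τ σ (t +̇ u)  = cong₂ _+̇_ (subT-∘ τ σ t) (subT-∘ τ σ u)
subT-∘ τ σ (t ×̇ u)  = cong₂ _×̇_ (subT-∘ τ σ t) (subT-∘ τ σ u)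

subT-numeral : (σ : Subst m n) (k : ℕ) → subT σ (numeral k) ≡ numeral k
subT-numeral σ zero    = refl
subT-numeral σ (suc k) = cong ṡ (subT-numeral σ k)

inst-wkT : (t u : Term n) → subT (inst u) (wkT t) ≡ t
inst-wkT t u = trans (subT-∘ (inst u) (var ∘ suc) t) (subT-id t)

lift-wkT : (σ : Subst m n) (t : Term m) → subT (lift σ) (wkT t) ≡ wkT (subT σ t)
lift-wkT σ t = trans (subT-∘ (lift σ) (var ∘ suc) t) (sym (subT-∘ (var ∘ suc) σ t))

lift-cong : {σ τ : Subst m n} → (∀ i → σ i ≡ τ i) → ∀ i → lift σ i ≡ lift τ i
lift-cong e zero    = refl
lift-cong e (suc i) = cong wkT (e i)

lift-id : (i : Fin (suc n)) → lift var i ≡ var i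
lift-id zero    = refl
lift-id (suc i) = refl

lift-∘ : (τ : Subst m n) (σ : Subst l m) → ∀ i → subT (lift τ) (lift σ i) ≡ lift (subT τ ∘ σ) i
lift-∘ τ σ zero    = refl
lift-∘ τ σ (suc i) = lift-wkT τ (σ i)

sub-cong : {σ τ : Subst m n} → (∀ i → σ i ≡ τ i) → ∀ φ → sub σ φ ≡ sub τ φ
sub-cong e ⊥̇        = refl
sub-cong e (t ≐ u)  = cong₂ _≐_ (subT-cong e t) (subT-cong e u)
sub-cong e (t ≤̇ u)  = cong₂ _≤̇_ (subT-cong e t) (subT-cong e u)
sub-cong e (φ ⇒ ψ)  = cong₂ _⇒_ (sub-cong e φ) (sub-cong e ψ)
sub-cong e (φ ∧̇ ψ)  = cong₂ _∧̇_ (sub-cong e φ) (sub-cong e ψ)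
sub-cong e (φ ∨̇ ψ)  = cong₂ _∨̇_ (sub-cong e φ) (sub-cong e ψ)
sub-cong e (∀̇ φ)    = cong ∀̇_ (sub-cong (lift-cong e) φ)
sub-cong e (∃̇ φ)    = cong ∃̇_ (sub-cong (lift-cong e) φ)

sub-id : (φ : Formula n) → sub var φ ≡ φ
sub-id ⊥̇        = refl
sub-id (t ≐ u)  = cong₂ _≐_ (subT-id t) (subT-id u)
sub-id (t ≤̇ u)  = cong₂ _≤̇_ (subT-id t) (subT-id u)
sub-id (φ ⇒ ψ)  = cong₂ _⇒_ (sub-id φ) (sub-id ψ)
sub-id (φ ∧̇ ψ)  = cong₂ _∧̇_ (sub-id φ) (sub-id ψ)
sub-id (φ ∨̇ ψ)  = cong₂ _∨̇_ (sub-id φ) (sub-id ψ)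
sub-id (∀̇ φ)    = cong ∀̇_ (trans (sub-cong lift-id φ) (sub-id φ))
sub-id (∃̇ φ)    = cong ∃̇_ (trans (sub-cong lift-id φ) (sub-id φ))

sub-∘ : (τ : Subst m n) (σ : Subst l m) → ∀ φ → sub τ (sub σ φ) ≡ sub (subT τ ∘ σ) φ
sub-∘ τ σ ⊥̇        = refl
sub-∘ τ σ (t ≐ u)  = cong₂ _≐_ (subT-∘ τ σ t) (subT-∘ τ σ u)
sub-∘ τ σ (t ≤̇ u)  = cong₂ _≤̇_ (subT-∘ τ σ t) (subT-∘ τ σ u)
sub-∘ τ σ (φ ⇒ ψ)  = cong₂ _⇒_ (sub-∘ τ σ φ) (sub-∘ τ σ ψ)
sub-∘ τ σ (φ ∧̇ ψ)  = cong₂ _∧̇_ (sub-∘ τ σ φ) (sub-∘ τ σ ψ)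
sub-∘ τ σ (φ ∨̇ ψ)  = cong₂ _∨̇_ (sub-∘ τ σ φ) (sub-∘ τ σ ψ)
sub-∘ τ σ (∀̇ φ)    = cong ∀̇_ (trans (sub-∘ (lift τ) (lift σ) φ) (sub-cong (lift-∘ τ σ) φ))
sub-∘ τ σ (∃̇ φ)    = cong ∃̇_ (trans (sub-∘ (lift τ) (lift σ) φ) (sub-cong (lift-∘ τ σ) φ))

sub-sub : {τ : Subst m n} {σ : Subst l m} {ρ : Subst l n} →
          (∀ i → subT τ (σ i) ≡ ρ i) → ∀ φ → sub τ (sub σ φ) ≡ sub ρ φ
sub-sub {τ = τ} {σ} e φ = trans (sub-∘ τ σ φ) (sub-cong e φ)

sub-inverse : {τ : Subst m n} {σ : Subst n m} →
              (∀ i → subT τ (σ i) ≡ var i) → ∀ φ → sub τ (sub σ φ) ≡ φ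
sub-inverse e φ = trans (sub-sub e φ) (sub-id φ)

-- After `∃E` the existential itself is weakened past the new variable. This identity lets it be
-- reintroduced there with that variable as witness.
lift-wk-inst : (φ : Formula (suc n)) → sub (lift (var ∘ suc)) φ [ var zero ] ≡ φ
lift-wk-inst = sub-inverse λ { zero → refl ; (suc i) → refl }

Δ₀-sub : (σ : Subst m n) {φ : Formula m} → Δ₀ φ → Δ₀ (sub σ φ)
Δ₀-sub σ ⊥̇        = ⊥̇
Δ₀-sub σ (t ≐ u)  = subT σ t ≐ subT σ u
Δ₀-sub σ (t ≤̇ u)  = subT σ t ≤̇ subT σ u
Δ₀-sub σ (d ⇒ e)  = Δ₀-sub σ d ⇒ Δ₀-sub σ e
Δ₀-sub σ (d ∧̇ e)  = Δ₀-sub σ d ∧̇ Δ₀-sub σ e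
Δ₀-sub σ (d ∨̇ e)  = Δ₀-sub σ d ∨̇ Δ₀-sub σ e
Δ₀-sub σ (∀≤ {φ} t d) =
  -- `∀≤` demands a bound that is literally of the form `wkT u`, so the lifted substitution has to
  -- move inside the weakening.
  subst (λ u → Δ₀ (∀̇ (var zero ≤̇ u ⇒ sub (lift σ) φ))) (sym (lift-wkT σ t))
    (∀≤ (subT σ t) (Δ₀-sub (lift σ) d))
Δ₀-sub σ (∃≤ {φ} t d) =
  subst (λ u → Δ₀ (∃̇ (var zero ≤̇ u ∧̇ sub (lift σ) φ))) (sym (lift-wkT σ t))
    (∃≤ (subT σ t) (Δ₀-sub (lift σ) d))

Σ₁-sub : (σ : Subst m n) {φ : Formula m} → Σ₁ φ → Σ₁ (sub σ φ)
Σ₁-sub σ (matrix d) = matrix (Δ₀-sub σ d)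
Σ₁-sub σ (∃̇ s)      = ∃̇ Σ₁-sub (lift σ) s

-- Derivations

weaken : Γ ⊆ Δ → T ∣ Γ ⊢ φ → T ∣ Δ ⊢ φ
weaken s (axiom a)   = axiom a
weaken s (hyp x)     = hyp (s x)
weaken s (⇒I d)      = ⇒I (weaken (∷⁺ʳ _ s) d)
weaken s (⇒E d e)    = ⇒E (weaken s d) (weaken s e)
weaken s (∧I d e)    = ∧I (weaken s d) (weaken s e)
weaken s (∧E₁ d)     = ∧E₁ (weaken s d)
weaken s (∧E₂ d)     = ∧E₂ (weaken s d)
weaken s (∨I₁ d)     = ∨I₁ (weaken s d)
weaken s (∨I₂ d)     = ∨I₂ (weaken s d)
weaken s (∨E d e f)  = ∨E (weaken s d) (weaken (∷⁺ʳ _ s) e) (weaken (∷⁺ʳ _ s) f)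
weaken s (raa d)     = raa (weaken (∷⁺ʳ _ s) d)
weaken s (∀I d)      = ∀I (weaken (map⁺ wk s) d)
weaken s (∀E d t)    = ∀E (weaken s d) t
weaken s (∃I t d)    = ∃I t (weaken s d)
weaken s (∃E d e)    = ∃E (weaken s d) (weaken (∷⁺ʳ _ (map⁺ wk s)) e)
weaken s (≐I t)      = ≐I t
weaken s (≐E φ d e)  = ≐E φ (weaken s d) (weaken s e)

cast : φ ≡ ψ → T ∣ Γ ⊢ φ → T ∣ Γ ⊢ ψ
cast refl d = d

weaken₀ : T ⊢ φ → T ∣ Γ ⊢ φ
weaken₀ = weaken λ ()

⇒-trans : T ⊢ φ ⇒ ψ → T ⊢ ψ ⇒ χ → T ⊢ φ ⇒ χ
⇒-trans d e = ⇒I (⇒E (weaken₀ e) (⇒E (weaken₀ d) (hyp (here refl))))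

⋀I : {Ψ : List (Formula n)} → All (T ⊢_) Ψ → T ⊢ ⋀ Ψ
⋀I []           = ≐I 0̇
⋀I (d ∷ [])     = d
⋀I (d ∷ e ∷ ds) = ∧I d (⋀I (e ∷ ds))

≐-cong : (f : Term (suc n)) {t u : Term n} →
         T ∣ Γ ⊢ t ≐ u → T ∣ Γ ⊢ subT (inst t) f ≐ subT (inst u) f
≐-cong {T = T} {Γ} f {t} {u} d =
  subst (λ v → T ∣ Γ ⊢ v ≐ subT (inst u) f) (inst-wkT _ u)
    -- The left side is weakened so that replacing `t` by `u` affects the right side only.
    (≐E (wkT (subT (inst t) f) ≐ f) d
      (subst (λ v → T ∣ Γ ⊢ v ≐ subT (inst t) f) (sym (inst-wkT _ t)) (≐I _)))

≐-sym : {t u : Term n} → T ∣ Γ ⊢ t ≐ u → T ∣ Γ ⊢ u ≐ t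
≐-sym {T = T} {Γ} {t} {u} d =
  subst (λ v → T ∣ Γ ⊢ u ≐ v) (inst-wkT t u)
    (≐E (var zero ≐ wkT t) d (subst (λ v → T ∣ Γ ⊢ t ≐ v) (sym (inst-wkT t t)) (≐I t)))

≐-trans : {t u v : Term n} → T ∣ Γ ⊢ t ≐ u → T ∣ Γ ⊢ u ≐ v → T ∣ Γ ⊢ t ≐ v
≐-trans {T = T} {Γ} {t} {u} {v} d e =
  subst (λ w → T ∣ Γ ⊢ w ≐ v) (inst-wkT t v)
    (≐E (wkT t ≐ var zero) e (subst (λ w → T ∣ Γ ⊢ w ≐ u) (sym (inst-wkT t u)) d))

+̇-cong : {t t′ u u′ : Term n} → T ∣ Γ ⊢ t ≐ t′ → T ∣ Γ ⊢ u ≐ u′ → T ∣ Γ ⊢ t +̇ u ≐ t′ +̇ u′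
+̇-cong {T = T} {Γ} {t} {t′} {u} {u′} d e = ≐-trans
  (subst₂ (λ v w → T ∣ Γ ⊢ t +̇ v ≐ t′ +̇ w) (inst-wkT u t) (inst-wkT u t′)
    (≐-cong (var zero +̇ wkT u) d))
  (subst₂ (λ v w → T ∣ Γ ⊢ v +̇ u ≐ w +̇ u′) (inst-wkT t′ u) (inst-wkT t′ u′)
    (≐-cong (wkT t′ +̇ var zero) e))

×̇-cong : {t t′ u u′ : Term n} → T ∣ Γ ⊢ t ≐ t′ → T ∣ Γ ⊢ u ≐ u′ → T ∣ Γ ⊢ t ×̇ u ≐ t′ ×̇ u′
×̇-cong {T = T} {Γ} {t} {t′} {u} {u′} d e = ≐-trans
  (subst₂ (λ v w → T ∣ Γ ⊢ t ×̇ v ≐ t′ ×̇ w) (inst-wkT u t) (inst-wkT u t′)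
    (≐-cong (var zero ×̇ wkT u) d))
  (subst₂ (λ v w → T ∣ Γ ⊢ v ×̇ u ≐ w ×̇ u′) (inst-wkT t′ u) (inst-wkT t′ u′)
    (≐-cong (wkT t′ ×̇ var zero) e))

-- Arithmetic of numerals

PA-+suc : (t u : Term n) → PA ∣ Γ ⊢ t +̇ ṡ u ≐ ṡ (t +̇ u)
PA-+suc {Γ = Γ} t u =
  subst (λ v → PA ∣ Γ ⊢ v +̇ ṡ u ≐ ṡ (v +̇ u)) (inst-wkT t u) (∀E (∀E (axiom +suc) t) u)

PA-×suc : (t u : Term n) → PA ∣ Γ ⊢ t ×̇ ṡ u ≐ t ×̇ u +̇ t
PA-×suc {Γ = Γ} t u =
  subst (λ v → PA ∣ Γ ⊢ v ×̇ ṡ u ≐ v ×̇ u +̇ v) (inst-wkT t u) (∀E (∀E (axiom ×suc) t) u)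

numeral-+ : (a b : ℕ) → PA ∣ Γ ⊢ numeral a +̇ numeral b ≐ numeral (a + b)
numeral-+ {Γ = Γ} a zero =
  subst (λ c → PA ∣ Γ ⊢ numeral a +̇ 0̇ ≐ numeral c) (sym (+-identityʳ a))
    (∀E (axiom +0) (numeral a))
numeral-+ {Γ = Γ} a (suc b) =
  subst (λ c → PA ∣ Γ ⊢ numeral a +̇ numeral (suc b) ≐ numeral c) (sym (+-suc a b))
    (≐-trans (PA-+suc (numeral a) (numeral b)) (≐-cong (ṡ (var zero)) (numeral-+ a b)))

numeral-* : (a b : ℕ) → PA ∣ Γ ⊢ numeral a ×̇ numeral b ≐ numeral (a * b)
numeral-* {Γ = Γ} a zero =
  subst (λ c → PA ∣ Γ ⊢ numeral a ×̇ 0̇ ≐ numeral c) (sym (*-zeroʳ a))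
    (∀E (axiom ×0) (numeral a))
numeral-* {Γ = Γ} a (suc b) =
  subst (λ c → PA ∣ Γ ⊢ numeral a ×̇ numeral (suc b) ≐ numeral c)
    (trans (+-comm (a * b) a) (sym (*-suc a b)))
    (≐-trans (PA-×suc (numeral a) (numeral b))
      (≐-trans (+̇-cong (numeral-* a b) (≐I _)) (numeral-+ (a * b) a)))

eval : Term 1 → ℕ → ℕ
eval (var _)  k = k
eval 0̇        k = 0
eval (ṡ t)    k = suc (eval t k)
eval (t +̇ u)  k = eval t k + eval u k
eval (t ×̇ u)  k = eval t k * eval u k

eval-numeral : (a k : ℕ) → eval (numeral a) k ≡ a
eval-numeral zero    k = refl
eval-numeral (suc a) k = cong suc (eval-numeral a k)

eval-sub : (t u : Term 1) (k : ℕ) → eval (subT (λ _ → u) t) k ≡ eval t (eval u k)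
eval-sub (var _)  u k = refl
eval-sub 0̇        u k = refl
eval-sub (ṡ t)    u k = cong suc (eval-sub t u k)
eval-sub (t +̇ t′) u k = cong₂ _+_ (eval-sub t u k) (eval-sub t′ u k)
eval-sub (t ×̇ t′) u k = cong₂ _*_ (eval-sub t u k) (eval-sub t′ u k)

-- One-variable terms are the polynomials that compute codes below; this is where PA verifies their
-- values, by its recursion equations for sum and product.
PA-eval : (t : Term 1) (k : ℕ) → PA ∣ Γ ⊢ subT (inst (numeral k)) t ≐ numeral (eval t k)
PA-eval (var zero) k = ≐I _
PA-eval 0̇          k = ≐I _
PA-eval (ṡ t)      k = ≐-cong (ṡ (var zero)) (PA-eval t k)
PA-eval (t +̇ u)    k = ≐-trans (+̇-cong (PA-eval t k) (PA-eval u k)) (numeral-+ (eval t k) (eval u k))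
PA-eval (t ×̇ u)    k = ≐-trans (×̇-cong (PA-eval t k) (PA-eval u k)) (numeral-* (eval t k) (eval u k))

-- The diagonal lemma

-- The conjunct is placed inside the existential prefix, so that the result is
-- again literally Σ₁.
guarded : Fin n → ℕ → {φ : Formula n} → Σ₁ φ → Formula n
guarded i k (matrix {φ} _) = var i ≐ numeral k ∧̇ φ
guarded i k (∃̇ s)          = ∃̇ guarded (suc i) k s

Σ₁-guarded : (i : Fin n) (k : ℕ) {φ : Formula n} (s : Σ₁ φ) → Σ₁ (guarded i k s)
Σ₁-guarded i k (matrix d) = matrix ((var i ≐ numeral k) ∧̇ d)
Σ₁-guarded i k (∃̇ s)      = ∃̇ Σ₁-guarded (suc i) k s

guarded-elim : (i : Fin n) (k : ℕ) {φ : Formula n} (s : Σ₁ φ) →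
               T ∣ Γ ⊢ guarded i k s → T ∣ Γ ⊢ var i ≐ numeral k ∧̇ φ
guarded-elim i k (matrix _) d = d
guarded-elim {T = T} {Γ = Γ} i k (∃̇_ {φ} s) d = ∃E d
  (∧I (cast (cong (var (suc i) ≐_) (sym (subT-numeral _ k))) (∧E₁ ih))
      (∃I (var zero) (cast (sym (lift-wk-inst φ)) (∧E₂ ih))))
  where
  ih : T ∣ guarded (suc i) k s ∷ map wk Γ ⊢ var (suc i) ≐ numeral k ∧̇ φ
  ih = guarded-elim (suc i) k s (hyp (here refl))

guarded-intro : (i : Fin n) (k : ℕ) {φ : Formula n} (s : Σ₁ φ) →
                T ∣ Γ ⊢ var i ≐ numeral k ∧̇ φ ⇒ guarded i k s
guarded-intro i k (matrix _) = ⇒I (hyp (here refl))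
guarded-intro {T = T} i k (∃̇_ {φ} s) = ⇒I (∃E (∧E₂ (hyp (here refl)))
  (∃I (var zero) (cast (sym (lift-wk-inst (guarded (suc i) k s)))
    (⇒E (guarded-intro (suc i) k s)
      (∧I (cast (cong (var (suc i) ≐_) (subT-numeral _ k))
            (∧E₁ (hyp (there (here refl)))))
          (hyp (here refl)))))))

-- The number that the guard will name: the code of the matrix, next to which the guard stands. The
-- quantifiers outside are accounted for by `depth`.
matrixCode : {φ : Formula n} → Σ₁ φ → ℕ
matrixCode (matrix {φ} _) = code φ
matrixCode (∃̇ s)          = matrixCode s

depth : {φ : Formula n} → Σ₁ φ → ℕ
depth (matrix _) = 0
depth (∃̇ s)      = suc (depth s)

-- Avoids a circularity: the term computing the code of the fixed point occurs inside `θ`, so it has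
-- to be built from the depth of `P`, before `θ` exists.
depth-sub : (σ : Subst m n) {φ : Formula m} (s : Σ₁ φ) → depth (Σ₁-sub σ s) ≡ depth s
depth-sub σ (matrix _) = refl
depth-sub σ (∃̇ s)      = cong suc (depth-sub (lift σ) s)

pair : Term n → Term n → Term n
pair t u = (t +̇ u) ×̇ (t +̇ u) +̇ t

-- `lead` counts the successors in one component, so the code is a polynomial in `k` and not an
-- iterated pairing. The 0 is ⟨ 0 , 0 ⟩, the tag and body of `0̇`.
codeT-numeral : (k : ℕ) → codeT (numeral {n} k) ≡ ⟨ k , 0 ⟩
codeT-numeral {n} k = cong₂ ⟨_,_⟩ (lead-numeral k) (cong₂ ⟨_,_⟩ (tagT-numeral k) (bodyT-numeral k))
  where
  lead-numeral : ∀ k → lead (numeral {n} k) ≡ k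
  lead-numeral zero    = refl
  lead-numeral (suc k) = cong suc (lead-numeral k)

  tagT-numeral : ∀ k → tagT (numeral {n} k) ≡ 0
  tagT-numeral zero    = refl
  tagT-numeral (suc k) = tagT-numeral k

  bodyT-numeral : ∀ k → bodyT (numeral {n} k) ≡ 0
  bodyT-numeral zero    = refl
  bodyT-numeral (suc k) = bodyT-numeral k

-- The variable stands for the matrix code, both as the number named in the guard and as the code of
-- the second conjunct. The tags 4, 1 and 7 are those of `∧̇`, `≐` and `∃̇`, and ⟨ 0 , ⟨ 1 , i ⟩ ⟩
-- codes the guarded variable, whose index grows under each quantifier.
guardedCode : (i d : ℕ) → Term 1
guardedCode i zero =
  pair (numeral 4)
    (pair (pair (numeral 1) (pair (numeral ⟨ 0 , ⟨ 1 , i ⟩ ⟩) (pair (var zero) 0̇))) (var zero))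
guardedCode i (suc d) = pair (numeral 7) (guardedCode (suc i) d)

code-guarded : (i : Fin n) {φ : Formula n} (s : Σ₁ φ) →
               code (guarded i (matrixCode s) s) ≡ eval (guardedCode (toℕ i) (depth s)) (matrixCode s)
code-guarded i (matrix {φ} _) =
  cong (λ a → ⟨ 4 , ⟨ ⟨ 1 , a ⟩ , code φ ⟩ ⟩)
    (cong₂ ⟨_,_⟩ (sym (eval-numeral ⟨ 0 , ⟨ 1 , toℕ i ⟩ ⟩ (code φ))) (codeT-numeral (code φ)))
code-guarded i (∃̇ s) = cong ⟨ 7 ,_⟩ (code-guarded (suc i) s)

-- The fixed point says that some x equals `k` and satisfies `θ`, where `θ` is `P` applied to a
-- polynomial in x and `k` is the code of the matrix of `θ`. The parameter `c` allows `P` to speak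
-- of a formula built from `σ`.
diagonal : {P : Formula 1} → Σ₁ P → (c : Term 1) →
           ∃[ σ ] Σ₁ σ × (PA ⊢ σ ⇔̇ P [ numeral (eval c (code σ)) ])
diagonal {P} p c = σ , ∃̇ Σ₁-guarded zero k s , ∧I (⇒I forward) (⇒I backward)
  where
  q : Term 1
  -- At the matrix code of `θ` the inner term gives the code of `σ`: 7 is the tag of its outer `∃̇`,
  -- which binds the guarded variable of index 0.
  q = subT (λ _ → pair (numeral 7) (guardedCode 0 (depth p))) c

  θ : Formula 1
  θ = sub (λ _ → q) P

  s : Σ₁ θ
  s = Σ₁-sub (λ _ → q) p

  k : ℕ
  k = matrixCode s

  σ : Sentence
  σ = ∃̇ guarded zero k s

  code-σ : eval (pair (numeral 7) (guardedCode 0 (depth p))) k ≡ code σ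
  code-σ = cong ⟨ 7 ,_⟩ (trans (cong (λ d → eval (guardedCode 0 d) k) (sym (depth-sub _ p)))
                               (sym (code-guarded zero s)))

  eval-q : eval q k ≡ eval c (code σ)
  eval-q = trans (eval-sub c _ k) (cong (eval c) code-σ)

  q[k] : PA ∣ Γ ⊢ subT (inst (numeral k)) q ≐ numeral (eval c (code σ))
  q[k] {Γ = Γ} = subst (λ a → PA ∣ Γ ⊢ subT (inst (numeral k)) q ≐ numeral a) eval-q (PA-eval q k)

  θ[k] : θ [ numeral k ] ≡ P [ subT (inst (numeral k)) q ]
  θ[k] = sub-sub (λ { zero → refl }) P

  forward : PA ∣ σ ∷ [] ⊢ P [ numeral (eval c (code σ)) ]
  forward = ≐E P q[k] (cast θ[k] (∃E (hyp (here refl))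
      (cast at-k
        (≐E θ′ (∧E₁ g) (cast (sym at-x) (∧E₂ g))))))
    where
    g : PA ∣ guarded zero k s ∷ map wk (σ ∷ []) ⊢ var zero ≐ numeral k ∧̇ θ
    g = guarded-elim zero k s (hyp (here refl))

    θ′ : Formula 2
    -- `≐E` rewrites index 0 of a formula with one more variable; the eigenvariable, now index 1,
    -- does not occur in `θ′`.
    θ′ = sub (λ _ → var zero) θ

    at-x : θ′ [ var zero ] ≡ θ
    at-x = sub-inverse (λ { zero → refl }) θ

    at-k : θ′ [ numeral k ] ≡ wk (θ [ numeral k ])
    at-k = trans (sub-∘ (inst (numeral k)) (λ _ → var zero) θ)
                 (sym (sub-sub (λ { zero → subT-numeral _ k }) θ))

  backward : PA ∣ P [ numeral (eval c (code σ)) ] ∷ [] ⊢ σ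
  -- Generalising the implication and instantiating it at `k` performs the substitution inside
  -- `guarded` without unfolding it.
  backward = ∃I (numeral k) (⇒E (∀E (∀I (guarded-intro zero k s)) (numeral k))
    (∧I (cast (cong (numeral k ≐_) (sym (subT-numeral _ k))) (≐I _))
        (cast (sym θ[k]) (≐E P (≐-sym q[k]) (hyp (here refl))))))

diagonal-¬⇒ : {P : Formula 1} → Σ₁ P → (A : Sentence) →
              ∃[ σ ] Σ₁ σ × (PA ⊢ σ ⇔̇ P [ ⌜ ¬̇ (A ⇒ σ) ⌝ ])
diagonal-¬⇒ {P} p A = σ , s , cast (cong (λ a → σ ⇔̇ P [ numeral a ]) code-¬⇒) fix
  where
  c : Term 1
  -- Negation is implication of `⊥̇`: both 3s are the tag of `⇒`, and `⊥̇` has code ⟨ 0 , 0 ⟩, which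
  -- is 0.
  c = pair (numeral 3) (pair (pair (numeral 3) (pair (numeral (code A)) (var zero))) 0̇)

  open Σ (diagonal p c) renaming (proj₁ to σ; proj₂ to σ-fixed)
  open Σ σ-fixed renaming (proj₁ to s; proj₂ to fix)

  code-¬⇒ : eval c (code σ) ≡ code (¬̇ (A ⇒ σ))
  code-¬⇒ = cong (λ a → ⟨ 3 , ⟨ ⟨ 3 , ⟨ a , code σ ⟩ ⟩ , 0 ⟩ ⟩) (eval-numeral (code A) (code σ))

-- Unprovability of consistency

-- `φ` and `σ` are kept apart although `T` proves them equivalent, since `Pr` need not respect that
-- equivalence. The unprovable instance is the one for `φ`.
⊬-ConS : {Pr : Formula 1} (φ σ : Sentence) → S ⊑ T → Consistent T →
         IsProvabilityPredicate S T Pr → T ⊢ φ ⇔̇ σ → S ⊢ σ ⇔̇ Pr [ ⌜ ¬̇ φ ⌝ ] →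
         S ⊢ σ ⇒ Pr [ ⌜ φ ⌝ ] → T ⊬ ConS Pr
⊬-ConS {T = T} {Pr} φ σ S⊑T conT isPr φ⇔σ fix pos =
  Con , (0 , φ , refl) , λ con → conT (⇒E (refutes con) (⇒E (∧E₂ φ⇔σ) (proves con)))
  where
  Con : Sentence
  Con = Pr [ ⌜ φ ⌝ ] ⇒ ¬̇ (Pr [ ⌜ ¬̇ φ ⌝ ])

  refutes : T ⊢ Con → T ⊢ ¬̇ φ
  -- From `σ`, `pos` yields provability of `φ` and `fix` that of its negation, against `Con`.
  refutes con = ⇒-trans (∧E₁ φ⇔σ) (⇒I (⇒E
    (⇒E (weaken₀ con) (⇒E (weaken₀ (S⊑T _ pos)) (hyp (here refl))))
    (⇒E (weaken₀ (∧E₁ (S⊑T _ fix))) (hyp (here refl)))))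

  proves : T ⊢ Con → T ⊢ σ
  proves con = S⊑T _ (⇒E (∧E₂ fix) (Equivalence.to (isPr (¬̇ φ)) (refutes con)))

⇒-identityˡ : T ⊢ φ → T ⊢ (φ ⇒ ψ) ⇔̇ ψ
⇒-identityˡ d = ∧I (⇒I (⇒E (hyp (here refl)) (weaken₀ d))) (⇒I (⇒I (hyp (there (here refl)))))

⇔-sym-trans : T ⊢ φ ⇔̇ ψ → T ⊢ ψ ⇔̇ χ → T ⊢ χ ⇔̇ φ
⇔-sym-trans d e = ∧I (⇒-trans (∧E₂ e) (∧E₂ d)) (⇒-trans (∧E₁ d) (∧E₁ e))

-- By `fix`, `σ` gives provability of the negation of `φ`; D3 makes this fact itself provable, and E
-- replaces it under `Pr` by `φ`, to which it is equivalent in `T`.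
E+D3⇒Pr-intro : {Pr : Formula 1} (φ σ : Sentence) → E S T Pr → D3 S Pr → S ⊑ T →
                T ⊢ φ ⇔̇ σ → S ⊢ σ ⇔̇ Pr [ ⌜ ¬̇ φ ⌝ ] → S ⊢ σ ⇒ Pr [ ⌜ φ ⌝ ]
E+D3⇒Pr-intro φ σ e d3 S⊑T φ⇔σ fix =
  ⇒-trans (∧E₁ fix) (⇒-trans (d3 (¬̇ φ)) (∧E₁ (e _ φ (⇔-sym-trans φ⇔σ (S⊑T _ fix)))))

theorem2p8 : (S T : Theory) → PA ⊑ S → PA ⊑ T → S ⊑ T →
    Consistent S → Consistent T → CETheory S → CETheory T →
    (Pr : Formula 1) → Σ₁ Pr → IsProvabilityPredicate S T Pr →
    (E S T Pr → D3 S Pr → T ⊬ ConS Pr) × (Σ₁C⁻ S T Pr → T ⊬ ConS Pr)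
theorem2p8 S T PA⊑S PA⊑T S⊑T conS conT ceS ceT Pr pr isPr = part₁ , part₂
  where
  -- The two parts differ only in the choice of `A` and in the source of the implication supplied by
  -- `pos`.
  unprovable : (A : Sentence) → T ⊢ A →
               (∀ σ → Σ₁ σ → T ⊢ (A ⇒ σ) ⇔̇ σ → S ⊢ σ ⇔̇ Pr [ ⌜ ¬̇ (A ⇒ σ) ⌝ ] →
                S ⊢ σ ⇒ Pr [ ⌜ A ⇒ σ ⌝ ]) →
               T ⊬ ConS Pr
  unprovable A ⊢A pos = from-fixed-point (diagonal-¬⇒ pr A)
    where
    from-fixed-point : ∃[ σ ] Σ₁ σ × (PA ⊢ σ ⇔̇ Pr [ ⌜ ¬̇ (A ⇒ σ) ⌝ ]) → T ⊬ ConS Pr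
    from-fixed-point (σ , s , d) = ⊬-ConS (A ⇒ σ) σ S⊑T conT isPr (⇒-identityˡ ⊢A) (PA⊑S _ d)
      (pos σ s (⇒-identityˡ ⊢A) (PA⊑S _ d))

  part₁ : E S T Pr → D3 S Pr → T ⊬ ConS Pr
  -- Any theorem of `T` could serve as `A` here; `⋀ []` is `0̇ ≐ 0̇`.
  part₁ e d3 = unprovable (⋀ []) (⋀I []) λ σ _ → E+D3⇒Pr-intro (⋀ [] ⇒ σ) σ e d3 S⊑T

  part₂ : Σ₁C⁻ S T Pr → T ⊬ ConS Pr
  part₂ (T₀ , ⊢T₀ , complete) = unprovable (⋀ T₀) (⋀I ⊢T₀) λ σ s _ _ → complete σ s
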